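{- (M-RSEP) Let $P:M\to U$ be a ($U$-small) family. Then the following type is inhabited: $$\prod_{x:M}\ \sum_{u:M}\ \prod_{z:M}\ \Bigl(z\in u\;\simeq\;\bigl(z\in x\;\wedge\;T\,(P\,z)\bigr)\Bigr).$$
   Context: The setting is Martin-Löf (homotopy/univalent) type theory with the Univalence Axiom (hence function extensionality); $A:\mathrm{Set}$ means "$A$ is a type" (not necessarily a 0-type), $A\simeq B$ is the type of equivalences as in the Homotopy Type Theory book, and $\wedge$ denotes the product type $\times$ (propositions-as-types). $U:\mathrm{Set}$ is a univalent universe with decoding function $T:U\to\mathrm{Set}$; univalent means that for $a,b:U$ the canonical map $\mathrm{Id}_U\,a\,b\to (T\,a\simeq T\,b)$ is an equivalence. $U$ is assumed closed under $+$, $\Sigma$-, $\Pi$- and identity types. $M := W_{a:U}\,T\,a$ is the W-type with canonical elements $\sup\,a\,f$, where $a:U$ and $f:T\,a\to M$. The relation $=_M\,:M\to M\to\mathrm{Set}$ is defined by recursion: $$(\sup\,a\,f)=_M(\sup\,b\,g)\;:=\;\sum_{\alpha:T a\simeq T b}\ \prod_{x:T a}\ (f\,x)=_M\bigl(g\,(\alpha\,x)\bigr).$$ The relation $\in\,:M\to M\to\mathrm{Set}$ is defined by $$x\in(\sup\,b\,g)\;:=\;\sum_{i:T b}\ x=_M(g\,i).$$ -}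

{-# OPTIONS --without-K #-}

-- K would refute univalence and so make every statement assuming it vacuous;
-- modules importing this one should also be --without-K.

module Defs where

open import Level using (Level; _⊔_)
open import Data.Container.Core using (_▷_)
open import Data.Product.Base using (Σ; Σ-syntax; _,_)
open import Data.Sum.Base using (_⊎_)
open import Data.W using (W; sup)
open import Function.Base using (id)
open import Function.Properties.Inverse.HalfAdjointEquivalence using (_≃_)
open import Relation.Binary.PropositionalEquality.Core using (_≡_; refl; cong)

private
  variable
    a b ι ℓ : Level

-- The fields of _≃_ other than to, so that A ≃ B is, up to packaging,
-- Σ[ f ∈ (A → B) ] IsEquiv f.

record IsEquiv {A : Set a} {B : Set b} (to : A → B) : Set (a ⊔ b) where
  field
    from             : B → A
    left-inverse-of  : ∀ x → from (to x) ≡ x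
    right-inverse-of : ∀ x → to (from x) ≡ x
    left-right       : ∀ x → cong to (left-inverse-of x) ≡ right-inverse-of (to x)

≃-refl : {A : Set a} → A ≃ A
≃-refl = record
  { to               = id
  ; from             = id
  ; left-inverse-of  = λ _ → refl
  ; right-inverse-of = λ _ → refl
  ; left-right       = λ _ → refl
  }

idToEquiv : {U : Set ι} (T : U → Set ℓ) {a b : U} → a ≡ b → T a ≃ T b
idToEquiv T refl = ≃-refl

Univalent : {U : Set ι} → (U → Set ℓ) → Set (ι ⊔ ℓ)
Univalent {U = U} T = (a b : U) → IsEquiv (idToEquiv T {a} {b})

UnivalenceAxiom : (ℓ : Level) → Set (Level.suc ℓ)
UnivalenceAxiom ℓ = Univalent {U = Set ℓ} id

-- Codes decode up to equivalence, which is implied by decoding up to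
-- judgemental or propositional equality.

record Closed {U : Set ℓ} (T : U → Set ℓ) : Set ℓ where
  field
    sum      : U → U → U
    sum-≃    : ∀ a b → T (sum a b) ≃ (T a ⊎ T b)
    sigma    : (a : U) → (T a → U) → U
    sigma-≃  : ∀ a b → T (sigma a b) ≃ (Σ[ x ∈ T a ] T (b x))
    pi       : (a : U) → (T a → U) → U
    pi-≃     : ∀ a b → T (pi a b) ≃ ((x : T a) → T (b x))
    ident    : (a : U) → T a → T a → U
    ident-≃  : ∀ a x y → T (ident a x y) ≃ (x ≡ y)

module Multiset {U : Set ℓ} (T : U → Set ℓ) where

  infix 4 _=M_ _∈_

  M : Set ℓ
  M = W (U ▷ T)

  _=M_ : M → M → Set ℓ
  sup (a , f) =M sup (b , g) =
    Σ[ α ∈ T a ≃ T b ] ((x : T a) → f x =M g (_≃_.to α x))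

  _∈_ : M → M → Set ℓ
  x ∈ sup (b , g) = Σ[ i ∈ T b ] (x =M g i)

{-# OPTIONS --without-K #-}
module Submission where

-- For x = sup a f and a small family P on M, take for u the multiset indexed
-- by (a code for) Σ (i : T a) , T (P (f i)), with elements f i.  Then
--
--   z ∈ u  ≃  Σ (i : T a) , T (P (f i)) × (z =M f i),
--   (z ∈ x) × T (P z)  ≃  Σ (i : T a) , (z =M f i) × T (P z),
--
-- and the summands on the right agree as soon as z =M f i gives an
-- equivalence T (P (f i)) ≃ T (P z).  This holds since x =M y implies x ≡ y
-- (=M⇒≡), so that T (P _) can be transported.
-- The implication is by induction on M: univalence of T reduces the
-- equivalence of indices to the identity, and function extensionality, which
-- follows from univalence (funext), then identifies the two families.

open import Defs
open import Level using (Level)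
open import Data.Product.Algebra using (Σ-assoc-alt; ×-comm)
open import Data.Product.Base using (Σ; Σ-syntax; _×_; _,_; proj₁)
open import Data.Product.Function.Dependent.Propositional using (Σ-↔)
open import Data.W using (sup)
open import Function.Base using (id; _∘_)
open import Function.Bundles using (_↔_)
open import Function.Properties.Inverse using (↔-refl; ↔-sym)
open import Function.Properties.Inverse.HalfAdjointEquivalence
  using (_≃_; ≃⇒↔; ↔⇒≃)
open import Function.Related.Propositional
  using (K-reflexive; module EquationalReasoning)
open import Relation.Binary.PropositionalEquality.Core
  using (_≡_; refl; cong; sym; subst)

private
  variable
    ℓ ι c p : Level

-- Equivalence induction: over a univalent family, a property of equivalences
-- between members of the family that holds of identities holds of all.
≃-induction : {U : Set ι} {T : U → Set ℓ} → Univalent T →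
  {a : U} (Q : (b : U) → T a ≃ T b → Set p) →
  Q a ≃-refl → {b : U} (α : T a ≃ T b) → Q b α
≃-induction {T = T} ua {a} Q q {b} α =
  subst (Q b) (right-inverse-of α) (base (from α))
  where
  open IsEquiv (ua a b)

  base : ∀ {b} (e : a ≡ b) → Q b (idToEquiv T e)
  base refl = q

precompose-injective : UnivalenceAxiom ℓ → {A B : Set ℓ} {C : Set c} →
  (α : A ≃ B) {g h : B → C} → g ∘ _≃_.to α ≡ h ∘ _≃_.to α → g ≡ h
precompose-injective ua {C = C} α =
  ≃-induction ua
    (λ B α → {g h : B → C} → g ∘ _≃_.to α ≡ h ∘ _≃_.to α → g ≡ h)
    id α

-- The type of all paths in A, with free endpoints.
Paths : Set ℓ → Set ℓ
Paths A = Σ[ x ∈ A ] Σ[ y ∈ A ] x ≡ y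

≃-Paths : {A : Set ℓ} → A ≃ Paths A
≃-Paths = record
  { to               = λ x → x , x , refl
  ; from             = proj₁
  ; left-inverse-of  = λ _ → refl
  ; right-inverse-of = λ { (_ , _ , refl) → refl }
  ; left-right       = λ _ → refl
  }

-- The two endpoint maps Paths B → B agree after precomposition with the
-- diagonal B ≃ Paths B, hence are equal.  A homotopy f ~ g is a map into
-- Paths B whose composites with the endpoint maps are f and g.
funext : UnivalenceAxiom ℓ → {A : Set c} {B : Set ℓ} {f g : A → B} →
  (∀ x → f x ≡ g x) → f ≡ g
funext ua {B = B} {f} {g} h =
  cong (λ endpoint x → endpoint (f x , g x , h x)) source≡target
  where
  source target : Paths B → B
  source (x , _ , _) = x
  target (_ , y , _) = y

  source≡target : source ≡ target
  source≡target = precompose-injective ua ≃-Paths refl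

module _ {U : Set ℓ} {T : U → Set ℓ} where
  open Multiset T

  =M⇒≡ : UnivalenceAxiom ℓ → Univalent T → (x y : M) → x =M y → x ≡ y
  =M⇒≡ ua univ (sup (a , f)) (sup (b , g)) (α , h) =
    ≃-induction univ
      (λ b α → (g : T b → M) → (∀ x → f x ≡ g (_≃_.to α x)) →
        sup (a , f) ≡ sup (b , g))
      (λ g f~g → cong (λ k → sup (a , k)) (funext ua f~g))
      α g (λ x → =M⇒≡ ua univ (f x) (g (_≃_.to α x)) (h x))

  -- The submultiset of x of those elements that satisfy P.
  separate : Closed T → (M → U) → M → M
  separate cl P (sup (a , f)) =
    sup (sigma a (P ∘ f) , f ∘ proj₁ ∘ _≃_.to (sigma-≃ a (P ∘ f)))
    where open Closed cl

  ∈-separate : UnivalenceAxiom ℓ → Univalent T → (cl : Closed T) →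
    (P : M → U) (x z : M) → (z ∈ separate cl P x) ↔ ((z ∈ x) × T (P z))
  ∈-separate ua univ cl P (sup (a , f)) z =
    (Σ[ k ∈ T (sigma a (P ∘ f)) ] z =M f (proj₁ (_≃_.to (sigma-≃ a (P ∘ f)) k)))
      ↔⟨ Σ-↔ (≃⇒↔ (sigma-≃ a (P ∘ f))) ↔-refl ⟩
    (Σ[ q ∈ Σ (T a) (T ∘ P ∘ f) ] z =M f (proj₁ q))
      ↔⟨ Σ-assoc-alt ⟩
    (Σ[ i ∈ T a ] T (P (f i)) × z =M f i)
      ↔⟨ Σ-↔ ↔-refl (×-comm _ _) ⟩
    (Σ[ i ∈ T a ] z =M f i × T (P (f i)))
      ↔⟨ Σ-↔ ↔-refl (Σ-↔ ↔-refl (λ {e} → transport e)) ⟩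
    (Σ[ i ∈ T a ] z =M f i × T (P z))
      ↔⟨ ↔-sym Σ-assoc-alt ⟩
    ((z ∈ sup (a , f)) × T (P z)) ∎
    where
    open Closed cl
    open EquationalReasoning

    transport : ∀ {w} → z =M w → T (P w) ↔ T (P z)
    transport {w} e = K-reflexive (cong (T ∘ P) (sym (=M⇒≡ ua univ z w e)))

proposition4 : {ℓ : Level} → UnivalenceAxiom ℓ →
    (U : Set ℓ) (T : U → Set ℓ) → Univalent T → Closed T →
    let open Multiset T in
    (P : M → U) →
    (x : M) → Σ[ u ∈ M ] ((z : M) → (z ∈ u) ≃ ((z ∈ x) × T (P z)))
proposition4 ua U T univ cl P x =
  separate cl P x , λ z → ↔⇒≃ (∈-separate ua univ cl P x z)
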